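{- Let $n\ge 1$ and $m\ge 2$ both be odd. Then $L_m(n)=0$.
   Context: The Ducci function $D:\mathbb{Z}_m^n\to\mathbb{Z}_m^n$ is $D(x_1,\dots,x_n)=(x_1+x_2,\,x_2+x_3,\,\dots,\,x_{n-1}+x_n,\,x_n+x_1)$, entries mod $m$. For $\mathbf{u}\in\mathbb{Z}_m^n$, $\mathrm{Len}(\mathbf{u})$ is the smallest $l\ge 0$ such that $D^{l+k}(\mathbf{u})=D^l(\mathbf{u})$ for some $k\ge 1$. $L_m(n)=\mathrm{Len}(0,0,\dots,0,1)$. -}

module Defs where

open import Data.Fin.Base using (Fin; toℕ; funToFin; finToFun)
open import Data.Fin.Properties as Fin using (pigeonhole; finToFun-funToFin)
open import Data.Nat.Base using (ℕ; zero; suc; _+_; _*_; _∸_; _^_; _≤_; z≤n; s≤s; NonZero; >-nonZero)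
open import Data.Nat.DivMod using (_mod_)
open import Data.Nat.GeneralisedArithmetic using (fold; fold-+)
open import Data.Nat.Properties using (+-assoc; +-comm; ≤-trans; <⇒≤; m≤m+n; m≤m*n; m∸n+n≡m; m<n⇒0<n∸m; n<1+n)
open import Data.Product.Base using (∃; _×_; _,_; proj₁; proj₂)
open import Data.Vec.Base using (Vec; []; _∷_; _∷ʳ_; zipWith; replicate; lookup; tabulate)
open import Data.Vec.Properties using (≡-dec; tabulate∘lookup; tabulate-cong)
open import Relation.Binary.PropositionalEquality using (_≡_; refl; sym; trans; cong; module ≡-Reasoning)
open import Relation.Nullary using (Dec; yes; no; contradiction)

-- ℤ/mℤ, represented by the residues 0, …, m-1.
ℤ/ : ℕ → Set
ℤ/ m = Fin m

infixl 6 _⊕_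

_⊕_ : ∀ {m} .{{_ : NonZero m}} → ℤ/ m → ℤ/ m → ℤ/ m
_⊕_ {m} a b = (toℕ a + toℕ b) mod m

-- (x₁, …, xₙ) ↦ (x₁ + x₂, …, xₙ₋₁ + xₙ, xₙ + x₁)
D : ∀ {m n} .{{_ : NonZero m}} → Vec (ℤ/ m) n → Vec (ℤ/ m) n
D []       = []
D (x ∷ xs) = zipWith _⊕_ (x ∷ xs) (xs ∷ʳ x)

D^ : ∀ {m n} .{{_ : NonZero m}} → ℕ → Vec (ℤ/ m) n → Vec (ℤ/ m) n
D^ l u = fold u D l

Recurs : ∀ {m n} .{{_ : NonZero m}} → Vec (ℤ/ m) n → ℕ → Set
Recurs u l = ∃ λ k → 1 ≤ k × D^ (l + k) u ≡ D^ l u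

IsLen : ∀ {m n} .{{_ : NonZero m}} → Vec (ℤ/ m) n → ℕ → Set
IsLen u l = Recurs u l × (∀ l′ → Recurs u l′ → l ≤ l′)

private
  least : (Q : ℕ → Set) → (∀ i → Dec (Q i)) → ∀ i → Q i →
          ∃ λ l → Q l × (∀ l′ → Q l′ → l ≤ l′)
  least Q Q? zero    q = 0 , q , λ _ _ → z≤n
  least Q Q? (suc i) q with Q? 0
  ... | yes q₀ = 0 , q₀ , λ _ _ → z≤n
  ... | no ¬q₀ with least (λ j → Q (suc j)) (λ j → Q? (suc j)) i q
  ...   | l , ql , min = suc l , ql , λ where
            zero     q₀ → contradiction q₀ ¬q₀
            (suc l′) q′ → s≤s (min l′ q′)

  encode : ∀ {m n} → Vec (Fin m) n → Fin (m ^ n)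
  encode v = funToFin (lookup v)

  encode-injective : ∀ {m n} (v w : Vec (Fin m) n) → encode v ≡ encode w → v ≡ w
  encode-injective v w eq = begin
    v                              ≡⟨ decode v ⟨
    tabulate (finToFun (encode v)) ≡⟨ cong (λ c → tabulate (finToFun c)) eq ⟩
    tabulate (finToFun (encode w)) ≡⟨ decode w ⟩
    w                              ∎
    where
    open ≡-Reasoning
    decode : ∀ v → tabulate (finToFun (encode v)) ≡ v
    decode v = trans (tabulate-cong (finToFun-funToFin (lookup v))) (tabulate∘lookup v)

  module _ {m n : ℕ} .{{_ : NonZero m}} (u : Vec (ℤ/ m) n) where

    a : ℕ → Vec (ℤ/ m) n
    a i = D^ i u

    shift : ∀ c {x y} → a x ≡ a y → a (c + x) ≡ a (c + y)
    shift c {x} {y} eq =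
      trans (fold-+ u D c) (trans (cong (D^ c) eq) (sym (fold-+ u D c)))

    repeat : ∀ {k l} → a (k + l) ≡ a l → ∀ t → a (t * k + l) ≡ a l
    repeat         eq zero    = refl
    repeat {k} {l} eq (suc t) =
      trans (cong a (+-assoc k (t * k) l)) (trans (shift k (repeat eq t)) eq)

    collision : ∃ λ i → ∃ λ k → 1 ≤ k × a (k + i) ≡ a i
    collision with pigeonhole (n<1+n (m ^ n)) (λ i → encode (a (toℕ i)))
    ... | i , j , i<j , eq =
      toℕ i , toℕ j ∸ toℕ i , m<n⇒0<n∸m i<j ,
      trans (cong a (m∸n+n≡m (<⇒≤ i<j))) (sym (encode-injective _ _ eq))

    -- A period valid somewhere along the orbit is valid at every recurring point.
    transfer : ∀ {i k} → a (k + i) ≡ a i → ∀ l → Recurs u l → a (k + l) ≡ a l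
    transfer {i} {k} eq l (k′ , 1≤k′ , eq′) = begin
      a (k + l)       ≡⟨ shift k around ⟨
      a (k + s)       ≡⟨ cong (λ x → a (k + x)) s≡c+i ⟩
      a (k + (c + i)) ≡⟨ cong a (trans (sym (+-assoc k c i)) (trans (cong (_+ i) (+-comm k c)) (+-assoc c k i))) ⟩
      a (c + (k + i)) ≡⟨ shift c eq ⟩
      a (c + i)       ≡⟨ cong a s≡c+i ⟨
      a s             ≡⟨ around ⟩
      a l             ∎
      where
      open ≡-Reasoning
      s = i * k′ + l
      c = s ∸ i
      s≡c+i : s ≡ c + i
      s≡c+i = sym (m∸n+n≡m (≤-trans (m≤m*n i k′ {{>-nonZero 1≤k′}}) (m≤m+n (i * k′) l)))
      around : a s ≡ a l
      around = repeat (trans (cong a (+-comm k′ l)) eq′) i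

len-exists : ∀ {m n} .{{_ : NonZero m}} (u : Vec (ℤ/ m) n) → ∃ (IsLen u)
len-exists u with collision u
... | i , k , 1≤k , eq
  with least (λ l → a u (k + l) ≡ a u l) (λ l → ≡-dec Fin._≟_ (a u (k + l)) (a u l)) i eq
...   | l , ql , min =
  l , (k , 1≤k , trans (cong (a u) (+-comm l k)) ql) , λ l′ r → min l′ (transfer u {i} {k} eq l′ r)

Len : ∀ {m n} .{{_ : NonZero m}} → Vec (ℤ/ m) n → ℕ
Len u = proj₁ (len-exists u)

Len-isLen : ∀ {m n} .{{_ : NonZero m}} (u : Vec (ℤ/ m) n) → IsLen u (Len u)
Len-isLen u = proj₂ (len-exists u)

-- (0, …, 0, 1)
basic : ∀ m n .{{_ : NonZero m}} .{{_ : NonZero n}} → Vec (ℤ/ m) n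
basic m (suc n) = replicate n (0 mod m) ∷ʳ (1 mod m)

L : ∀ m n .{{_ : NonZero m}} .{{_ : NonZero n}} → ℕ
L m n = Len (basic m n)

{-# OPTIONS --safe #-}

-- For n and m odd, D is injective: if D u = D v then the differences d = u - v
-- alternate, d i = - d (i + 1), and going once around a cycle of odd length gives
-- 2 d = 0, hence d = 0 as m is odd.  An injective map has purely periodic orbits.
module Submission where

open import Defs
open import Data.Nat.Base using (ℕ; _≤_; NonZero)
open import Data.Nat.Divisibility using (_∤_)
open import Relation.Binary.PropositionalEquality using (_≡_)

open import Data.Fin.Base using (toℕ)
open import Data.Fin.Properties using (toℕ-fromℕ<; toℕ-injective; toℕ<n)
open import Data.Integer.Base as ℤ using (ℤ; +_)
open import Data.Integer.Divisibility.Signed as ℤ∣ using (divides; ∣m∣n⇒∣m+n; ∣m∣n⇒∣m-n; ∣m+n∣m⇒∣n; ∣ᵤ⇒∣; ∣⇒∣ᵤ)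
open import Data.Integer.Properties using (abs-*; pos-*; +-injective; ∣i∣≡0⇒i≡0; i-j≡0⇒i≡j; ∣m⊝n∣≤m⊔n; m-n≡m⊖n)
open import Data.Integer.Tactic.RingSolver using (solve-∀)
open import Data.Nat.Base as ℕ using (zero; suc; _<_)
open import Data.Nat.Divisibility as ℕ∣ using (_∣_; divides-refl; >⇒∤; m∣m*n)
open import Data.Nat.DivMod using (_/_; _%_; _mod_; m%n<n; m≡m%n+[m/n]*n)
open import Data.Nat.GeneralisedArithmetic using (fold; fold-+)
open import Data.Nat.Primality using (euclidsLemma; prime[2])
import Data.Nat.Properties as ℕₚ
open import Data.Product.Base using (_,_)
open import Data.Sum.Base using (inj₁; inj₂)
open import Data.Vec.Base using (Vec; []; _∷_; _∷ʳ_; zipWith)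
open import Data.Vec.Properties using (∷-injective)
open import Function.Definitions using (Injective)
open import Relation.Binary.PropositionalEquality using (refl; sym; trans; cong; cong₂; subst; module ≡-Reasoning)
open import Relation.Nullary using (contradiction)

∤-+ˡ : ∀ {d n} → d ∤ d ℕ.+ n → d ∤ n
∤-+ˡ d∤d+n d∣n = d∤d+n (ℕ∣.∣m∣n⇒∣m+n ℕ∣.∣-refl d∣n)

-- As 2 is prime and does not divide `m`, it must divide the cofactor `q`; one factor 2 then cancels
-- from both sides.
odd∣2*⇒∣ : ∀ {m a} → 2 ∤ m → m ∣ 2 ℕ.* a → m ∣ a
odd∣2*⇒∣ {m} {a} 2∤m (ℕ∣.divides q 2a≡qm) with euclidsLemma q m prime[2] (subst (2 ∣_) 2a≡qm (m∣m*n a))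
... | inj₂ 2∣m = contradiction 2∣m 2∤m
... | inj₁ (divides-refl r) = ℕ∣.divides r (ℕₚ.*-cancelˡ-≡ a (r ℕ.* m) 2 (begin
  2 ℕ.* a           ≡⟨ 2a≡qm ⟩
  r ℕ.* 2 ℕ.* m     ≡⟨ cong (ℕ._* m) (ℕₚ.*-comm r 2) ⟩
  2 ℕ.* r ℕ.* m     ≡⟨ ℕₚ.*-assoc 2 r m ⟩
  2 ℕ.* (r ℕ.* m)   ∎))
  where open ≡-Reasoning

∣∧<⇒≡0 : ∀ {m a} → m ∣ a → a < m → a ≡ 0
∣∧<⇒≡0 {a = zero}  _   _   = refl
∣∧<⇒≡0 {a = suc _} m∣a a<m = contradiction m∣a (>⇒∤ a<m)

fold-injective : ∀ {A : Set} {f : A → A} → Injective _≡_ _≡_ f →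
                 ∀ l → Injective _≡_ _≡_ (λ x → fold x f l)
fold-injective f-inj zero    eq = eq
fold-injective f-inj (suc l) eq = fold-injective f-inj l (f-inj eq)

module _ {m : ℕ} .{{_ : NonZero m}} where

  -- The difference is taken between integer representatives and its vanishing mod `m` is expressed
  -- as divisibility by `+ m`, so that subtraction and ring identities in ℤ are at hand.
  δ : ℤ/ m → ℤ/ m → ℤ
  δ x y = + toℕ x ℤ.- + toℕ y

  mod-≡⇒∣- : ∀ a b → a mod m ≡ b mod m → + m ℤ∣.∣ (+ a ℤ.- + b)
  -- The equal remainders cancel, which leaves the difference of the quotients as cofactor.
  mod-≡⇒∣- a b eq = divides (+ (a / m) ℤ.- + (b / m)) (begin
    + a ℤ.- + b
      ≡⟨ cong₂ ℤ._-_ (expand a) (expand b) ⟩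
    (+ (a % m) ℤ.+ + (a / m) ℤ.* + m) ℤ.- (+ (b % m) ℤ.+ + (b / m) ℤ.* + m)
      ≡⟨ cong (λ r → (+ r ℤ.+ + (a / m) ℤ.* + m) ℤ.- (+ (b % m) ℤ.+ + (b / m) ℤ.* + m)) %-eq ⟩
    (+ (b % m) ℤ.+ + (a / m) ℤ.* + m) ℤ.- (+ (b % m) ℤ.+ + (b / m) ℤ.* + m)
      ≡⟨ cancel (+ (b % m)) (+ (a / m)) (+ (b / m)) (+ m) ⟩
    (+ (a / m) ℤ.- + (b / m)) ℤ.* + m ∎)
    where
    open ≡-Reasoning
    expand : ∀ c → + c ≡ + (c % m) ℤ.+ + (c / m) ℤ.* + m
    expand c = trans (cong +_ (m≡m%n+[m/n]*n c m))
                     (cong (λ z → + (c % m) ℤ.+ z) (pos-* (c / m) m))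
    %-eq : a % m ≡ b % m
    %-eq = trans (sym (toℕ-fromℕ< (m%n<n a m))) (trans (cong toℕ eq) (toℕ-fromℕ< (m%n<n b m)))
    cancel : ∀ r p q k → (r ℤ.+ p ℤ.* k) ℤ.- (r ℤ.+ q ℤ.* k) ≡ (p ℤ.- q) ℤ.* k
    cancel = solve-∀

  ⊕-≡⇒∣δ+δ : ∀ x x′ y y′ → x ⊕ x′ ≡ y ⊕ y′ → + m ℤ∣.∣ (δ x y ℤ.+ δ x′ y′)
  ⊕-≡⇒∣δ+δ x x′ y y′ eq =
    subst (+ m ℤ∣.∣_) (regroup (+ toℕ x) (+ toℕ x′) (+ toℕ y) (+ toℕ y′))
      (mod-≡⇒∣- (toℕ x ℕ.+ toℕ x′) (toℕ y ℕ.+ toℕ y′) eq)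
    where
    regroup : ∀ a a′ b b′ → (a ℤ.+ a′) ℤ.- (b ℤ.+ b′) ≡ (a ℤ.- b) ℤ.+ (a′ ℤ.- b′)
    regroup = solve-∀

  -- Representatives lie in `[0, m)`, so their difference has absolute value below `m`, and the only
  -- such multiple of `m` is 0.
  ∣δ⇒≡ : ∀ x y → + m ℤ∣.∣ δ x y → x ≡ y
  ∣δ⇒≡ x y m∣δ = toℕ-injective (+-injective (i-j≡0⇒i≡j _ _ (∣i∣≡0⇒i≡0 (∣∧<⇒≡0 (∣⇒∣ᵤ m∣δ) ∣δ∣<m))))
    where
    ∣δ∣<m : ℤ.∣ δ x y ∣ < m
    ∣δ∣<m = subst (λ z → ℤ.∣ z ∣ < m) (sym (m-n≡m⊖n (toℕ x) (toℕ y)))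
      (ℕₚ.≤-<-trans (∣m⊝n∣≤m⊔n (toℕ x) (toℕ y)) (ℕₚ.⊔-lub (toℕ<n x) (toℕ<n y)))

  odd∣i+i⇒∣i : 2 ∤ m → ∀ i → + m ℤ∣.∣ (i ℤ.+ i) → + m ℤ∣.∣ i
  odd∣i+i⇒∣i 2∤m i m∣i+i = ∣ᵤ⇒∣ (odd∣2*⇒∣ 2∤m
    (subst (m ∣_) (trans (cong ℤ.∣_∣ (double i)) (abs-* (+ 2) i)) (∣⇒∣ᵤ m∣i+i)))
    where
    double : ∀ i → i ℤ.+ i ≡ + 2 ℤ.* i
    double = solve-∀

  -- The cycle cut open: the last entry `z` is independent of the first, which lets induction move
  -- `x` along while `z` stays fixed. `D (x ∷ xs)` is definitionally `pathSums x xs x`.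
  pathSums : ∀ {n} → ℤ/ m → Vec (ℤ/ m) n → ℤ/ m → Vec (ℤ/ m) (suc n)
  pathSums x xs z = zipWith _⊕_ (x ∷ xs) (xs ∷ʳ z)

  -- The differences alternate along the path, which has an odd number of edges.
  endpoints : ∀ {n} → 2 ∤ suc n → ∀ x y (xs ys : Vec (ℤ/ m) n) z w →
              pathSums x xs z ≡ pathSums y ys w → + m ℤ∣.∣ (δ x y ℤ.+ δ z w)
  endpoints odd x y [] [] z w eq with e , _ ← ∷-injective eq = ⊕-≡⇒∣δ+δ x z y w e
  endpoints odd x y (_ ∷ []) (_ ∷ []) z w eq = contradiction ℕ∣.∣-refl odd
  endpoints odd x y (x₁ ∷ x₂ ∷ xs) (y₁ ∷ y₂ ∷ ys) z w eq
    with e₁ , eq₁ ← ∷-injective eq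
    with e₂ , eq₂ ← ∷-injective eq₁ =
    -- Subtracting the relations of the first two edges eliminates `δ x₁ y₁`. Dropping edges in
    -- pairs keeps their number odd.
    subst (+ m ℤ∣.∣_) (telescope (δ x y) (δ x₁ y₁) (δ x₂ y₂) (δ z w))
      (∣m∣n⇒∣m+n (∣m∣n⇒∣m-n (⊕-≡⇒∣δ+δ x x₁ y y₁ e₁) (⊕-≡⇒∣δ+δ x₁ x₂ y₁ y₂ e₂))
                 (endpoints (∤-+ˡ odd) x₂ y₂ xs ys z w eq₂))
    where
    telescope : ∀ a b c d → ((a ℤ.+ b) ℤ.- (b ℤ.+ c)) ℤ.+ (c ℤ.+ d) ≡ a ℤ.+ d
    telescope = solve-∀

  -- Vanishing propagates forward: neighbouring differences sum to 0 mod `m`, so if one is 0 then so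
  -- is the next.
  pathSums-injective : ∀ {n} x y (xs ys : Vec (ℤ/ m) n) z w → + m ℤ∣.∣ δ x y →
                       pathSums x xs z ≡ pathSums y ys w → x ∷ xs ≡ y ∷ ys
  pathSums-injective x y [] [] z w m∣δ eq = cong (_∷ []) (∣δ⇒≡ x y m∣δ)
  pathSums-injective x y (x₁ ∷ xs) (y₁ ∷ ys) z w m∣δ eq
    with e , eq₁ ← ∷-injective eq =
    cong₂ _∷_ (∣δ⇒≡ x y m∣δ)
      (pathSums-injective x₁ y₁ xs ys z w (∣m+n∣m⇒∣n {m = δ x y} (⊕-≡⇒∣δ+δ x x₁ y y₁ e) m∣δ) eq₁)

  D-injective : ∀ {n} → 2 ∤ n → 2 ∤ m → Injective _≡_ _≡_ (D {m} {n})
  D-injective 2∤n 2∤m {[]}     {[]}     _  = refl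
  D-injective 2∤n 2∤m {x ∷ xs} {y ∷ ys} eq =
    -- Closing the path with `z = x` and `w = y` turns the conclusion of `endpoints` into
    -- divisibility of `δ x y` doubled.
    pathSums-injective x y xs ys x y
      (odd∣i+i⇒∣i 2∤m (δ x y) (endpoints 2∤n x y xs ys x y eq)) eq

  D-injective⇒Len≡0 : ∀ {n} → Injective _≡_ _≡_ (D {m} {n}) → ∀ u → Len u ≡ 0
  D-injective⇒Len≡0 D-inj u with (k , 1≤k , eq) , min ← Len-isLen u =
    -- With `l = Len u`, the recurrence reads `D^ l (D^ k u) ≡ D^ l u`. Cancelling the injective
    -- `D^ l` makes index 0 recurrent, and minimality gives `l ≤ 0`.
    ℕₚ.n≤0⇒n≡0 (min 0 (k , 1≤k ,
      fold-injective D-inj (Len u) (trans (sym (fold-+ u D (Len u))) eq)))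

theorem2p2 : ∀ (n m : ℕ) .{{_ : NonZero n}} .{{_ : NonZero m}} →
    1 ≤ n → 2 ≤ m → 2 ∤ n → 2 ∤ m → L m n ≡ 0
theorem2p2 n m _ _ 2∤n 2∤m = D-injective⇒Len≡0 (D-injective 2∤n 2∤m) (basic m n)
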